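{- Let $1\le k\le n$. For each of the three semantics DPAL, EDPAL and ADPAL, the formula $$K_0\Big(P_0^{k-1}\wedge K_1\big(P_1^{k-2}\wedge\cdots K_{k-1}(P_{k-1}^0)\cdots\big)\Big)\to\varphi_k$$ is true in every muddy children model $\hat M_n$ in the initial state $(1,\dots,1,0,\dots,0)$ (first $k$ entries equal to $1$), where $$\varphi_k=\langle\neg K_{k-1}m_{k-1}\rangle\langle\neg K_{k-2}m_{k-2}\rangle\cdots\langle\neg K_1m_1\rangle K_0m_0 .$$
   Context: Muddy children models: the agents are $0,1,\dots,n-1$; the states are the tuples in $\{0,1\}^n$ other than the all-zero tuple; for each agent $i$, $s\sim_i s'$ iff $s$ and $s'$ agree in all coordinates other than coordinate $i$ (coordinates are numbered $0,\dots,n-1$); the atom $m_i$ ("child $i$ is muddy") is true at $s$ iff the $i$-th coordinate of $s$ is $1$. A muddy children model $\hat M_n$ is this structure equipped with an arbitrary depth function $d$. Children $0,\dots,k-1$ are the muddy ones in the initial state. $\langle\varphi\rangle\psi:=\neg[\varphi]\neg\psi$. Language: $\varphi ::= p \mid E_a^d \mid P_a^d \mid \neg\varphi \mid \varphi\wedge\varphi \mid K_a\varphi \mid K_a^\infty\varphi \mid [\varphi]\varphi$ with $p$ an atom, $a$ an agent, $d\in\mathbb{N}=\{0,1,\dots\}$. Modal depth: $d(p)=d(E_a^d)=d(P_a^d)=0$, $d(\neg\varphi)=d(\varphi)$, $d(\varphi\wedge\psi)=\max(d(\varphi),d(\psi))$, $d(K_a\varphi)=d(K_a^\infty\varphi)=1+d(\varphi)$,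 $d([\varphi]\psi)=d(\varphi)+d(\psi)$. Models are tuples $M=(\mathcal{S},\sim,V,d)$ with states $\mathcal{S}$, relations $\sim_a$ (equivalence relations for DPAL and EDPAL, reflexive relations for ADPAL), valuation $V$ of atoms, and depth function $d(a,s)\in\mathbb{N}$ (in EDPAL it may take values in $\mathbb{Z}$). Common clauses: $(M,s)\models p$ iff $p\in V(s)$; $(M,s)\models E_a^d$ iff $d(a,s)=d$; $(M,s)\models P_a^d$ iff $d(a,s)\ge d$; $\neg,\wedge$ as usual; $(M,s)\models K_a^\infty\varphi$ iff $(M,s')\models\varphi$ for all $s'$ with $s\sim_a s'$; $(M,s)\models K_a\varphi$ iff $(M,s)\models P_a^{d(\varphi)}\wedge K_a^\infty\varphi$. Announcements. DPAL: $(M,s)\models[\varphi]\psi$ iff ($(M,s)\models\varphi$ implies $(M\mid\varphi,(1,s))\models\psi$), where $M\mid\varphi$ has states $(\{0\}\times\mathcal{S})\cup\{(1,s):(M,s)\models\varphi\}$; $\sim'_a$ is the transitive symmetric closure of $R_a$ given by $(i,s)R_a(i,s')$ iff $s\sim_a s'$ ($i=0,1$) and $(1,s)R_a(0,s)$ iff $(M,s)\not\models P_a^{d(\varphi)}$; $V'((i,s))=V(s)$; $d'(a,(0,s))=d(a,s)$; $d'(a,(1,s))=d(a,s)$ if $d(a,s)<d(\varphi)$, else $d(a,s)-d(\varphi)$. EDPAL: $(M,s)\models[\varphi]\psi$ iff ($(M,s)\models\varphi$ implies $(M\mid\varphi,s)\models\psi$), where $M\mid\varphi$ has states $\{s:(M,s)\models\varphi\}$,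 restricted relations and valuation, and $d'(a,s)=d(a,s)-d(\varphi)$. ADPAL: $(M,s)\models[\varphi]\psi$ iff ($(M,s)\models\varphi$ implies $(M\mid\varphi,s)\models\psi$), where $M\mid\varphi$ has the same states and valuation; $s\not\sim'_a s'$ iff $s\not\sim_a s'$ or [$(M,s)\models P_a^{d(\varphi)}$ and ($(M,s)\models\varphi$ iff $(M,s')\not\models\varphi$)]; $d'(a,s)=d(a,s)$ if $d(a,s)<d(\varphi)$, else $d(a,s)-d(\varphi)$. -}

module Defs where

open import Data.Bool.Base using (Bool; true; false; if_then_else_)
open import Data.Fin.Base using (Fin; zero; suc; toℕ; fromℕ; inject₁; inject≤)
open import Data.Integer.Base as ℤ using (ℤ; +_)
open import Data.Nat.Base as ℕ using (ℕ; zero; suc; _+_; _∸_; _⊔_; _≤_; z≤n; s≤s; _<ᵇ_)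
open import Data.Irrelevant using () renaming ([_] to irr)
open import Data.Product.Base using (Σ; Σ-syntax; _×_; _,_; proj₁)
open import Data.Refinement.Base using (Refinement-syntax; value; _,_)
open import Data.Sum.Base using (_⊎_; inj₁; inj₂)
open import Data.Vec.Base using (Vec; lookup; tabulate; replicate)
open import Function.Base using (_∘_)
open import Function.Bundles using (_⇔_; Equivalence)
open import Level using (0ℓ)
open import Relation.Binary.Construct.Closure.Symmetric as Sym using (SymClosure; fwd)
open import Relation.Binary.Construct.Closure.Transitive as Trans using (TransClosure)
open import Relation.Binary.Core using (Rel)
open import Relation.Binary.Definitions using (Reflexive)
open import Relation.Binary.PropositionalEquality.Core using (_≡_; _≢_; refl; sym; trans)
open import Relation.Binary.Structures using (IsEquivalence)
open import Relation.Nullary.Negation.Core using (¬_)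

private
  variable
    Agent Atom : Set

infix  8 ~_
infixr 7 _∧_
infixr 6 _⇒_
infixr 8 [_]_ ⟨_⟩_

data Formula (Agent Atom : Set) : Set where
  atom : Atom → Formula Agent Atom
  E P  : Agent → ℕ → Formula Agent Atom
  ~_   : Formula Agent Atom → Formula Agent Atom
  _∧_  : Formula Agent Atom → Formula Agent Atom → Formula Agent Atom
  K K∞ : Agent → Formula Agent Atom → Formula Agent Atom
  [_]_ : Formula Agent Atom → Formula Agent Atom → Formula Agent Atom

⟨_⟩_ : Formula Agent Atom → Formula Agent Atom → Formula Agent Atom
⟨ φ ⟩ ψ = ~ ([ φ ] (~ ψ))

_⇒_ : Formula Agent Atom → Formula Agent Atom → Formula Agent Atom
φ ⇒ ψ = ~ (φ ∧ (~ ψ))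

modalDepth : Formula Agent Atom → ℕ
modalDepth (atom _)  = 0
modalDepth (E _ _)   = 0
modalDepth (P _ _)   = 0
modalDepth (~ φ)     = modalDepth φ
modalDepth (φ ∧ ψ)   = modalDepth φ ⊔ modalDepth ψ
modalDepth (K _ φ)   = 1 + modalDepth φ
modalDepth (K∞ _ φ)  = 1 + modalDepth φ
modalDepth ([ φ ] ψ) = modalDepth φ + modalDepth ψ

-- `Depth` is where the depth function takes its values (ℕ or ℤ), and `IsAcc`
-- is the condition on the accessibility relations (equivalence or reflexive).
record Model (Agent Atom Depth : Set) (IsAcc : {S : Set} → Rel S 0ℓ → Set) : Set₁ where
  field
    State : Set
    acc   : Agent → Rel State 0ℓ
    isAcc : ∀ a → IsAcc (acc a)
    V     : Atom → State → Set
    depth : Agent → State → Depth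

-- The three logics share all clauses of the satisfaction relation but
-- differ in their classes of models and in the effect of an announcement φ.
-- The latter depends on φ only through its truth set and its modal depth, so
-- that satisfaction can be defined by structural recursion on formulas.
record Semantics (Agent Atom : Set) : Set₂ where
  field
    Depth  : Set
    fromℕᵈ : ℕ → Depth
    _≥ᵈ_   : Rel Depth 0ℓ
    IsAcc  : {S : Set} → Rel S 0ℓ → Set
    -- used only to turn a structure with equivalence relations into a model
    equivalence⇒isAcc : {S : Set} (R : Rel S 0ℓ) → IsEquivalence R → IsAcc R

  𝕄 : Set₁
  𝕄 = Model Agent Atom Depth IsAcc

  open Model

  field
    announce : (M : 𝕄) (Truth : State M → Set) (c : ℕ) → 𝕄
    current  : (M : 𝕄) (Truth : State M → Set) (c : ℕ)
               (s : State M) → Truth s → State (announce M Truth c)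

  infix 4 _⊨_

  _⊨_ : Σ 𝕄 State → Formula Agent Atom → Set
  (M , s) ⊨ atom p    = V M p s
  (M , s) ⊨ E a d     = depth M a s ≡ fromℕᵈ d
  (M , s) ⊨ P a d     = depth M a s ≥ᵈ fromℕᵈ d
  (M , s) ⊨ (~ φ)     = ¬ ((M , s) ⊨ φ)
  (M , s) ⊨ (φ ∧ ψ)   = ((M , s) ⊨ φ) × ((M , s) ⊨ ψ)
  (M , s) ⊨ K a φ     = (depth M a s ≥ᵈ fromℕᵈ (modalDepth φ))
                        × (∀ t → acc M a s t → (M , t) ⊨ φ)
  (M , s) ⊨ K∞ a φ    = ∀ t → acc M a s t → (M , t) ⊨ φ
  (M , s) ⊨ ([ φ ] ψ) =
    (sφ : (M , s) ⊨ φ) →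
    ( announce M (λ t → (M , t) ⊨ φ) (modalDepth φ)
    , current M (λ t → (M , t) ⊨ φ) (modalDepth φ) s sφ ) ⊨ ψ

-- depth left to an agent of depth d after an announcement of modal depth c
pay : ℕ → ℕ → ℕ
pay c d = if d <ᵇ c then d else d ∸ c

module DPALUpdate (M : Model Agent Atom ℕ IsEquivalence)
                  (Truth : Model.State M → Set) (c : ℕ) where
  open Model M

  -- `inj₁ s` stands for (0,s) and `inj₂ (s , _)` for (1,s); nothing below
  -- depends on the proof carried by the latter.
  State′ : Set
  State′ = State ⊎ (Σ[ s ∈ State ] Truth s)

  base : State′ → State
  base (inj₁ s)       = s
  base (inj₂ (s , _)) = s

  data R (a : Agent) : Rel State′ 0ℓ where
    before : ∀ {s t} → acc a s t → R a (inj₁ s) (inj₁ t)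
    after  : ∀ {s t p q} → acc a s t → R a (inj₂ (s , p)) (inj₂ (t , q))
    unsure : ∀ {s p} → ¬ (depth a s ℕ.≥ c) → R a (inj₂ (s , p)) (inj₁ s)

  acc′ : Agent → Rel State′ 0ℓ
  acc′ a = TransClosure (SymClosure (R a))

  R-refl : ∀ a → Reflexive (R a)
  R-refl a {inj₁ _} = before (IsEquivalence.refl (isAcc a))
  R-refl a {inj₂ _} = after (IsEquivalence.refl (isAcc a))

  depth′ : Agent → State′ → ℕ
  depth′ a (inj₁ s)       = depth a s
  depth′ a (inj₂ (s , _)) = pay c (depth a s)

  updated : Model Agent Atom ℕ IsEquivalence
  updated = record
    { State = State′
    ; acc   = acc′
    ; isAcc = λ a → record
        { refl  = Trans.reflexive _ (fwd (R-refl a))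
        ; sym   = Trans.symmetric _ (Sym.symmetric (R a))
        ; trans = Trans.transitive _
        }
    ; V     = λ p x → V p (base x)
    ; depth = depth′
    }

DPAL : Semantics Agent Atom
DPAL = record
  { Depth  = ℕ
  ; fromℕᵈ = λ d → d
  ; _≥ᵈ_   = ℕ._≥_
  ; IsAcc  = IsEquivalence
  ; equivalence⇒isAcc = λ _ e → e
  ; announce = DPALUpdate.updated
  ; current  = λ _ _ _ s p → inj₂ (s , p)
  }

EDPAL : Semantics Agent Atom
EDPAL = record
  { Depth  = ℤ
  ; fromℕᵈ = +_
  ; _≥ᵈ_   = ℤ._≥_
  ; IsAcc  = IsEquivalence
  ; equivalence⇒isAcc = λ _ e → e
  ; announce = λ M Truth c → let open Model M in record
      { State = Σ[ s ∈ State ] Truth s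
      ; acc   = λ a x y → acc a (proj₁ x) (proj₁ y)
      ; isAcc = λ a → record
          { refl  = IsEquivalence.refl (isAcc a)
          ; sym   = IsEquivalence.sym (isAcc a)
          ; trans = IsEquivalence.trans (isAcc a)
          }
      ; V     = λ p x → V p (proj₁ x)
      ; depth = λ a x → depth a (proj₁ x) ℤ.- + c
      }
  ; current  = λ _ _ _ s p → s , p
  }

ADPAL : Semantics Agent Atom
ADPAL = record
  { Depth  = ℕ
  ; fromℕᵈ = λ d → d
  ; _≥ᵈ_   = ℕ._≥_
  ; IsAcc  = λ R → Reflexive R
  ; equivalence⇒isAcc = λ _ e → IsEquivalence.refl e
  ; announce = λ M Truth c → let open Model M in record
      { State = State
      ; acc   = λ a s t →
          acc a s t × ¬ ((depth a s ℕ.≥ c) × (Truth s ⇔ (¬ Truth t)))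
      ; isAcc = λ a → isAcc a , λ (_ , p⇔¬p) →
          let open Equivalence p⇔¬p
              ¬p = λ p → to p p
          in ¬p (from ¬p)
      ; V     = V
      ; depth = λ a s → pay c (depth a s)
      }
  ; current  = λ _ _ _ s _ → s
  }

-- Refinement makes the proof of nonzeroness irrelevant, so that a depth
-- function on these states is a function of the tuple alone.
MuddyState : ℕ → Set
MuddyState n = [ s ∈ Vec Bool n ∣ s ≢ replicate n false ]

-- Agents and atoms are both indexed by `Fin n`; the atom `i` is m_i.
muddyModel : ∀ {n} (L : Semantics (Fin n) (Fin n)) →
             (Fin n → MuddyState n → Semantics.Depth L) → Semantics.𝕄 L
muddyModel {n} L d = record
  { State = MuddyState n
  ; acc   = agree
  ; isAcc = λ i → Semantics.equivalence⇒isAcc L (agree i) (record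
      { refl  = λ _ _ → refl
      ; sym   = λ f j j≢i → sym (f j j≢i)
      ; trans = λ f g j j≢i → trans (f j j≢i) (g j j≢i)
      })
  ; V     = λ i s → lookup (value s) i ≡ true
  ; depth = d
  }
  where
  agree : Fin n → Rel (MuddyState n) 0ℓ
  agree i s t = ∀ j → j ≢ i → lookup (value s) j ≡ lookup (value t) j

initialBits : ∀ n → ℕ → Vec Bool n
initialBits n k = tabulate (λ i → toℕ i <ᵇ k)

initialBits-nonzero : ∀ {n k} → 1 ≤ k → k ≤ n → initialBits n k ≢ replicate n false
initialBits-nonzero (s≤s _) (s≤s _) ()

initial : ∀ {n k} → 1 ≤ k → k ≤ n → MuddyState n
initial {n} {k} 1≤k k≤n = initialBits n k , irr (initialBits-nonzero 1≤k k≤n)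

-- Below, `c` lists the k muddy children c 0 , … , c (k-1).

-- K_{c 0}(P_{c 0}^{k-1} ∧ K_{c 1}(P_{c 1}^{k-2} ∧ ⋯ K_{c (k-1)} P_{c (k-1)}^0 ⋯))
budget : ∀ {k} → 1 ≤ k → (Fin k → Agent) → Formula Agent Atom
budget {k = suc zero}    _ c = K (c zero) (P (c zero) 0)
budget {k = suc (suc j)} _ c =
  K (c zero) (P (c zero) (suc j) ∧ budget (s≤s z≤n) (c ∘ suc))

-- ⟨¬K_{c (k-1)} m_{c (k-1)}⟩ ⋯ ⟨¬K_{c 1} m_{c 1}⟩ K_{c 0} m_{c 0}
φ : ∀ {k} → 1 ≤ k → (Fin k → Agent) → Formula Agent Agent
φ {k = suc zero}    _ c = K (c zero) (atom (c zero))
φ {k = suc (suc j)} _ c =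
  ⟨ ~ K last (atom last) ⟩ φ (s≤s z≤n) (c ∘ inject₁)
  where last = c (fromℕ (suc j))

TrueInMuddyModels : ∀ {n} → Semantics (Fin n) (Fin n) →
                    MuddyState n → Formula (Fin n) (Fin n) → Set
TrueInMuddyModels {n} L s ψ =
  (d : Fin n → MuddyState n → Semantics.Depth L) →
  Semantics._⊨_ L (muddyModel L d , s) ψ

children : ∀ {n k} → k ≤ n → Fin k → Fin n
children k≤n i = inject≤ i k≤n

{-# OPTIONS --safe #-}

-- Write s_j for the state in which exactly the children c j , … , c (k-1) are
-- muddy.  Child c (k-1) knows her status in s_{k-1}, so the first announcement
-- excludes s_{k-1}; then c (k-2) knows hers in s_{k-2}, and so on, until s_1 is
-- excluded and c 0 knows that she is muddy in s_0.  This backward induction is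
-- the predicate `Resolves` below: each announcement removes its last layer at
-- the price of one unit of depth.  The announcements are truthful because a
-- state with c 0 muddy is never excluded (`Unsure`): every other child still
-- considers possible the state that differs from it by her being clean.
-- What an announcement does to the states it keeps is the same in all three
-- semantics (`AnnouncementLaws`).

module Submission where

open import Defs
open import Data.Bool.Base using (true; false; T)
open import Data.Bool.Properties using (¬-not; T-≡)
open import Data.Empty using (⊥; ⊥-elim; ⊥-elim-irr)
open import Data.Fin.Base using (Fin; zero; suc; toℕ; fromℕ; fromℕ<; inject₁)
open import Data.Fin.Properties using (_≟_; toℕ-injective; toℕ-inject≤; toℕ-fromℕ<)
open import Data.Integer.Base as ℤ using (+_)
import Data.Integer.Properties as ℤ
open import Data.Irrelevant using () renaming ([_] to irr)
open import Data.Nat.Base using (ℕ; zero; suc; _+_; _∸_; _<ᵇ_; _≤_; _<_; _≥_; z≤n; s≤s)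
open import Data.Nat.Properties using (<ᵇ⇒<; <⇒≱; ∸-monoˡ-≤; m+n∸m≡n; m≤m+n; ≤-trans)
open import Data.Product.Base using (Σ-syntax; ∃; _×_; _,_; proj₁; proj₂)
open import Data.Refinement.Base using (value; _,_)
open import Data.Sum.Base using (_⊎_; inj₁; inj₂; fromInj₁)
open import Data.Unit.Base using (⊤; tt)
open import Data.Vec.Base using (lookup; _[_]≔_)
open import Data.Vec.Properties using (lookup∘tabulate; lookup∘update; lookup∘update′; lookup-replicate)
open import Data.Vec.Relation.Binary.Pointwise.Extensional using (Pointwise-≡⇒≡; ext)
open import Function.Base using (_∘_; id)
open import Function.Bundles using (Equivalence; mk⇔)
open import Level using (0ℓ)
open import Relation.Binary.Construct.Closure.Symmetric using (SymClosure; fwd; bwd)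
open import Relation.Binary.Construct.Closure.Transitive using (TransClosure; [_]; _∷_)
open import Relation.Binary.Core using (Rel)
open import Relation.Binary.Definitions using (Reflexive)
open import Relation.Binary.PropositionalEquality
open import Relation.Binary.Structures using (IsEquivalence)
open import Relation.Nullary.Decidable.Core using (yes; no)
open import Relation.Nullary.Negation.Core using (¬_; contradiction; negated-stable)
open import Relation.Unary using (Pred)

open Model

-- Laws of announcements common to the semantics

module _ {Agent Atom : Set} (L : Semantics Agent Atom) where
  open Semantics L

  -- `Copy x y`: y is the state that x becomes in the announced model, where x
  -- is one of the states at which the announcement is true.
  record CopyLaws (M : 𝕄) (Truth : Pred (State M) 0ℓ) (c : ℕ) : Set₁ where
    private M′ = announce M Truth c
    field
      Copy         : State M → State M′ → Set
      copy-current : ∀ {x} (p : Truth x) → Copy x (current M Truth c x p)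
      copy-true    : ∀ {x y} → Copy x y → Truth x
      copy-V       : ∀ {x y} → Copy x y → ∀ q → V M′ q y ≡ V M q x
      copy-depth   : ∀ {x y} → Copy x y → ∀ {a e} →
                     depth M a x ≥ᵈ fromℕᵈ (c + e) → depth M′ a y ≥ᵈ fromℕᵈ e
      acc-to-copy  : ∀ {x y t a} → Copy x y → Truth t → acc M a x t →
                     ∃ λ u → Copy t u × acc M′ a y u
      -- The depth is needed at all states accessible from x, because in DPAL
      -- any one of them may link the announced copies to the old ones.
      acc-from-copy : ∀ {x y u a e} → (∀ t → ¬ ¬ Truth t → Truth t) → Copy x y →
                      (∀ t → acc M a x t → depth M a t ≥ᵈ fromℕᵈ (c + e)) →
                      acc M′ a y u → ∃ λ t → Copy t u × acc M a x t

  record AnnouncementLaws : Set₁ where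
    field
      acc-refl : {S : Set} {R : Rel S 0ℓ} → IsAcc R → Reflexive R
      copyLaws : ∀ M Truth c → CopyLaws M Truth c

-- Verification of the laws in DPAL, EDPAL and ADPAL

pay-≥ : ∀ c {d e} → d ≥ c + e → pay c d ≥ e
pay-≥ c {d} {e} c+e≤d with d <ᵇ c in d<ᵇc
... | true  = contradiction (≤-trans (m≤m+n c e) c+e≤d)
                            (<⇒≱ (<ᵇ⇒< d c (subst T (sym d<ᵇc) tt)))
... | false = subst (_≤ d ∸ c) (m+n∸m≡n c e) (∸-monoˡ-≤ c c+e≤d)

minus-≥ : ∀ c {d e} → d ℤ.≥ + (c + e) → d ℤ.- + c ℤ.≥ + e
minus-≥ c {d} {e} c+e≤d = subst (ℤ._≤ d ℤ.- + c) eq (ℤ.+-monoˡ-≤ (ℤ.- + c) c+e≤d)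
  where
  eq : + (c + e) ℤ.- + c ≡ + e
  eq = trans (ℤ.m-n≡m⊖n (c + e) c)
             (trans (ℤ.⊖-≥ (m≤m+n c e)) (cong +_ (m+n∸m≡n c e)))

module _ {Agent Atom : Set} where

  module _ (M : Model Agent Atom ℕ IsEquivalence) (Truth : Pred (State M) 0ℓ) (c : ℕ) where
    open DPALUpdate M Truth c

    DPAL-Copy : State M → State′ → Set
    DPAL-Copy x y = Σ[ p ∈ Truth x ] y ≡ inj₂ (x , p)

    module _ {a : Agent} {e : ℕ} where
      private module Eq = IsEquivalence (isAcc M a)

      -- Only `unsure` links new states to old ones, and it is absent at depth at least `c`.
      step-from-copy : ∀ {x y u} → DPAL-Copy x y → depth M a x ≥ c + e →
                       SymClosure (R a) y u → ∃ λ t → DPAL-Copy t u × acc M a x t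
      step-from-copy (p , refl) _     (fwd (after r))       = _ , (_ , refl) , r
      step-from-copy (p , refl) _     (bwd (after r))       = _ , (_ , refl) , Eq.sym r
      step-from-copy (p , refl) c+e≤d (fwd (unsure d≱c)) =
        contradiction (≤-trans (m≤m+n c e) c+e≤d) d≱c

      path-from-copy : ∀ {x y u} → DPAL-Copy x y →
                       (∀ t → acc M a x t → depth M a t ≥ c + e) →
                       acc′ a y u → ∃ λ t → DPAL-Copy t u × acc M a x t
      path-from-copy cp deep [ r ] = step-from-copy cp (deep _ Eq.refl) r
      path-from-copy cp deep (r ∷ rs) with step-from-copy cp (deep _ Eq.refl) r
      -- By transitivity the depth bound moves along the path.
      ... | _ , cp′ , x∼x′ with path-from-copy cp′ (λ t → deep t ∘ Eq.trans x∼x′) rs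
      ...   | t , cp″ , x′∼t = t , cp″ , Eq.trans x∼x′ x′∼t

  DPAL-laws : AnnouncementLaws (DPAL {Agent} {Atom})
  DPAL-laws = record
    { acc-refl = IsEquivalence.refl
    ; copyLaws = λ M Truth c → record
      { Copy          = DPAL-Copy M Truth c
      ; copy-current  = λ p → p , refl
      ; copy-true     = proj₁
      ; copy-V        = λ { (_ , refl) _ → refl }
      ; copy-depth    = λ { (_ , refl) → pay-≥ c }
      ; acc-to-copy   = λ { (_ , refl) q r → _ , (q , refl) , [ fwd (DPALUpdate.after r) ] }
      ; acc-from-copy = λ {_} {_} {_} {_} {e} _ → path-from-copy M Truth c {e = e}
      }
    }

  EDPAL-laws : AnnouncementLaws (EDPAL {Agent} {Atom})
  EDPAL-laws = record
    { acc-refl = IsEquivalence.refl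
    ; copyLaws = λ M Truth c → record
      { Copy          = λ x y → proj₁ y ≡ x
      ; copy-current  = λ _ → refl
      ; copy-true     = λ { {y = _ , p} refl → p }
      ; copy-V        = λ { refl _ → refl }
      ; copy-depth    = λ { refl → minus-≥ c }
      ; acc-to-copy   = λ { refl q r → (_ , q) , refl , r }
      ; acc-from-copy = λ { _ refl _ r → _ , refl , r }
      }
    }

  ADPAL-laws : AnnouncementLaws (ADPAL {Agent} {Atom})
  ADPAL-laws = record
    { acc-refl = λ r → r
    ; copyLaws = λ M Truth c → record
      { Copy          = λ x y → Truth x × y ≡ x
      ; copy-current  = λ p → p , refl
      ; copy-true     = proj₁
      ; copy-V        = λ { (_ , refl) _ → refl }
      ; copy-depth    = λ { (_ , refl) → pay-≥ c }
      ; acc-to-copy   = λ { (p , refl) q r →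
          _ , (q , refl) , r , λ (_ , p⇔¬q) → Equivalence.to p⇔¬q p q }
      -- A link kept from a true state cannot lead to a false one, as the depth at its source
      -- suffices to cut it. Stability turns "not false" into truth.
      ; acc-from-copy = λ { {e = e} stable (p , refl) deep (r , kept) →
          _ , (stable _ (λ ¬q → kept ( ≤-trans (m≤m+n c e) (deep _ (isAcc M _))
                                     , mk⇔ (λ _ → ¬q) (λ _ → p)))
              , refl) , r }
      }
    }

-- Backward induction through the announcements

module _ {Agent : Set} {L : Semantics Agent Agent} where
  open Semantics L

  Resolves : ∀ {k} (M : 𝕄) → (Fin k → Agent) → State M → Set
  Resolves {zero}  M c x = ⊥
  Resolves {suc k} M c x = ∀ t → acc M (c zero) x t →
    depth M (c zero) t ≥ᵈ fromℕᵈ k × (V M (c zero) t ⊎ Resolves M (c ∘ suc) t)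

  -- The nesting makes the clean witnesses themselves survive: each announcement costs one level.
  Unsure : ℕ → (M : 𝕄) → Agent → State M → Set
  Unsure zero    M b x = ⊤
  Unsure (suc k) M b x = ∀ a → a ≢ b →
    ∃ λ t → acc M a x t × ¬ V M a t × Unsure k M b t

  unsure⇒¬K : ∀ {k M a b x} → a ≢ b → Unsure (suc k) M b x → (M , x) ⊨ (~ K a (atom a))
  unsure⇒¬K a≢b unsure (_ , known) with unsure _ a≢b
  ... | t , r , ¬m , _ = ¬m (known t r)

  module _ (laws : AnnouncementLaws L) where
    open AnnouncementLaws laws

    private
      module Announced (M : 𝕄) (a : Agent) where
        Truth : Pred (State M) 0ℓ
        Truth t = (M , t) ⊨ (~ K a (atom a))
        -- `1` is the modal depth of `~ K a (atom a)`.
        M′ = announce M Truth 1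
        open CopyLaws (copyLaws M Truth 1) public

    unsure-announce : ∀ {M a b} k {x y} → let open Announced M a in
      a ≢ b → Copy x y → Unsure (suc k) M b x → Unsure k M′ b y
    unsure-announce zero _ _ _ = tt
    unsure-announce {M} {a} (suc k) a≢b cp unsure i i≢b with unsure i i≢b
    ... | t , r , ¬m , unsure-t
      with acc-to-copy cp (unsure⇒¬K {k} a≢b unsure-t) r
      where open Announced M a
    ...   | u , cp′ , r′ = u , r′ , ¬m ∘ subst id (copy-V cp′ i)
                         , unsure-announce k a≢b cp′ unsure-t
      where open Announced M a

    resolves₁⇒K : ∀ M (c : Fin 1 → Agent) {x} → Resolves M c x →
                  (M , x) ⊨ K (c zero) (atom (c zero))
    resolves₁⇒K M c res = proj₁ (res _ (acc-refl (isAcc M _)))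
                        , λ t r → fromInj₁ ⊥-elim (proj₂ (res t r))

    -- At the last layer the child would know that she is muddy, contradicting the announcement that
    -- every copied state satisfies.
    resolves-announce : ∀ {M} k (c : Fin (suc k) → Agent) {x y} →
      let open Announced M (c (fromℕ k)) in
      Copy x y → Resolves M c x → Resolves M′ (c ∘ inject₁) y
    resolves-announce {M} zero c cp res = copy-true cp (resolves₁⇒K M c res)
      where open Announced M (c zero)
    resolves-announce {M} (suc k) c cp res u r′
      -- The announcement is a negation, hence stable. The bound `suc k` is read as `1 + k`: one
      -- unit pays for it and `k` remain.
      with acc-from-copy (λ _ → negated-stable) cp (λ t r → proj₁ (res t r)) r′
      where open Announced M (c (suc (fromℕ k)))
    ... | t , cp′ , r with res t r
    ...   | deep , inj₁ m     = copy-depth cp′ deep , inj₁ (subst id (sym (copy-V cp′ _)) m)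
      where open Announced M (c (suc (fromℕ k)))
    ...   | deep , inj₂ res-t = copy-depth cp′ deep , inj₂ (resolves-announce k (c ∘ suc) cp′ res-t)
      where open Announced M (c (suc (fromℕ k)))

    resolves⇒φ : ∀ {M} k (c : Fin (suc k) → Agent) {x} → (∀ i → c (suc i) ≢ c zero) →
                 Resolves M c x → Unsure k M (c zero) x → (M , x) ⊨ φ (s≤s z≤n) c
    resolves⇒φ {M} zero c _ res _ = resolves₁⇒K M c res
    resolves⇒φ {M} (suc k) c c≢ res unsure ¬φ =
      ¬φ truthful (resolves⇒φ k (c ∘ inject₁) (c≢ ∘ inject₁)
                    (resolves-announce (suc k) c (copy-current truthful) res)
                    (unsure-announce k (c≢ _) (copy-current truthful) unsure))
      where
      open Announced M (c (suc (fromℕ k)))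
      truthful = unsure⇒¬K {k} (c≢ (fromℕ k)) unsure

-- Muddy children models

MuddyAmong : ∀ {n k} → (Fin k → Fin n) → MuddyState n → Set
MuddyAmong c s = ∀ i → lookup (value s) i ≡ true → ∃ λ j → c j ≡ i

¬muddyAmong-none : ∀ {n} {c : Fin 0 → Fin n} s → ¬ MuddyAmong c s
¬muddyAmong-none {n} (v , irr v≢0) among = ⊥-elim-irr (v≢0 (Pointwise-≡⇒≡ (ext λ i →
  trans (¬-not λ m → noFin (among i m)) (sym (lookup-replicate i false)))))
  where
  noFin : ∀ {P : Fin 0 → Set} → ¬ ∃ P
  noFin (() , _)

module _ {n} {L : Semantics (Fin n) (Fin n)} (d : Fin n → MuddyState n → Semantics.Depth L) where
  open Semantics L

  private M = muddyModel L d

  -- Child `c zero` doubts only her own coordinate, so if she is clean in `t`, the muddy children of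
  -- `t` are muddy in `s` too.
  muddy-or-fewer : ∀ {k} {c : Fin (suc k) → Fin n} s t → MuddyAmong c s →
                   acc M (c zero) s t → V M (c zero) t ⊎ MuddyAmong (c ∘ suc) t
  muddy-or-fewer {c = c} s t among r with lookup (value t) (c zero) in clean
  ... | true  = inj₁ refl
  ... | false = inj₂ fewer
    where
    fewer : MuddyAmong (c ∘ suc) t
    fewer i m with i ≟ c zero
    ... | yes refl = contradiction (trans (sym m) clean) λ ()
    ... | no i≢c₀ with among i (trans (r i i≢c₀) m)
    ...   | zero  , c₀≡i = contradiction (sym c₀≡i) i≢c₀
    ...   | suc j , cj≡i = j , cj≡i

  budget⇒resolves : ∀ k (c : Fin (suc k) → Fin n) s → MuddyAmong c s →
                    (M , s) ⊨ budget (s≤s z≤n) c → Resolves {L = L} M c s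
  budget⇒resolves zero c s among (_ , deep) t r with muddy-or-fewer s t among r
  ... | inj₁ m     = deep t r , inj₁ m
  -- With no candidate left, `t` would be the excluded all-zero tuple.
  ... | inj₂ fewer = contradiction fewer (¬muddyAmong-none t)
  budget⇒resolves (suc k) c s among (_ , rest) t r with rest t r | muddy-or-fewer s t among r
  ... | deep , _      | inj₁ m     = deep , inj₁ m
  ... | deep , budget | inj₂ fewer = deep , inj₂ (budget⇒resolves k (c ∘ suc) t fewer budget)

  muddy⇒unsure : ∀ {b} k s → lookup (value s) b ≡ true → Unsure {L = L} k M b s
  muddy⇒unsure zero    s m = tt
  muddy⇒unsure {b} (suc k) s m a a≢b =
    t , (λ j j≢a → sym (lookup∘update′ j≢a v false))
      , (λ a-muddy → contradiction (trans (sym (lookup∘update a v false)) a-muddy) λ ())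
      , muddy⇒unsure k t b-muddy
    where
    v = value s
    b-muddy : lookup (v [ a ]≔ false) b ≡ true
    b-muddy = trans (lookup∘update′ (a≢b ∘ sym) v false) m
    t : MuddyState n
    -- Child `a` is made clean; `b` stays muddy, so the tuple is nonzero.
    t = v [ a ]≔ false , irr λ v≡0 → contradiction
      (trans (sym (lookup-replicate b false)) (trans (sym (cong (λ w → lookup w b) v≡0)) b-muddy))
      λ ()

initial-muddyAmong : ∀ {n k} (1≤k : 1 ≤ k) (k≤n : k ≤ n) →
                     MuddyAmong (children k≤n) (initial 1≤k k≤n)
initial-muddyAmong {n} {k} 1≤k k≤n i m = fromℕ< i<k , toℕ-injective
  (trans (toℕ-inject≤ (fromℕ< i<k) k≤n) (toℕ-fromℕ< i<k))
  where
  i<k : toℕ i < k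
  i<k = <ᵇ⇒< (toℕ i) k
    (Equivalence.from T-≡ (trans (sym (lookup∘tabulate (λ j → toℕ j <ᵇ k) i)) m))

true-in-muddy-models : ∀ {n k} {L : Semantics (Fin n) (Fin n)} → AnnouncementLaws L →
  (1≤k : 1 ≤ k) (k≤n : k ≤ n) →
  TrueInMuddyModels L (initial 1≤k k≤n) (budget 1≤k (children k≤n) ⇒ φ 1≤k (children k≤n))
-- These patterns make `k` and `n` successors, so that `inject≤` computes: `λ _ ()` separates the
-- other children from child 0, and `refl` shows her muddy.
true-in-muddy-models {L = L} laws (s≤s z≤n) k≤n@(s≤s _) d (hasBudget , ¬φ) =
  ¬φ (resolves⇒φ laws _ (children k≤n) (λ _ ())
       (budget⇒resolves d _ (children k≤n) _ (initial-muddyAmong (s≤s z≤n) k≤n) hasBudget)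
       (muddy⇒unsure {L = L} d _ (initial (s≤s z≤n) k≤n) refl))

theorem6p1 : (n k : ℕ) (1≤k : 1 ≤ k) (k≤n : k ≤ n) →
    let ψ = budget 1≤k (children k≤n) ⇒ φ 1≤k (children k≤n)
        s = initial 1≤k k≤n
    in TrueInMuddyModels DPAL s ψ × TrueInMuddyModels EDPAL s ψ × TrueInMuddyModels ADPAL s ψ
theorem6p1 n k 1≤k k≤n =
    true-in-muddy-models DPAL-laws 1≤k k≤n
  , true-in-muddy-models EDPAL-laws 1≤k k≤n
  , true-in-muddy-models ADPAL-laws 1≤k k≤n
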